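{- Let $\mathbf A$ be a balanced residuated poset satisfying $1_x\cdot1_y=1_{xy}$, $1_{x\backslash y}=1_x\cdot1_y$ and $1_{x/y}=1_x\cdot1_y$ for all $x,y\in A$, and let $\mathbf I=\langle\mathrm{Id}^+\mathbf A,\cdot\rangle$ be the join semilattice of its positive idempotents. Then the algebraic reduct $\langle A,\cdot,\backslash,/,1\rangle$ of $\mathbf A$ is the Płonka sum of the semilattice directed system of metamorphisms between its components $\Xi=\{\xi_{pq}\text{ from }\mathbf A_p\text{ to }\mathbf A_q : p\le q\text{ in }\mathbf I\}$ given by $$\xi^1_{pq}=\langle\varphi_{pq}\rangle,\quad \xi^{\cdot}_{pq}=\langle\varphi_{pq},\varphi_{pq},\varphi_{pq}\rangle,\quad \xi^{\backslash}_{pq}=\langle\psi_{pq},\varphi_{pq},\psi_{pq}\rangle,\quad \xi^{/}_{pq}=\langle\psi_{pq},\psi_{pq},\varphi_{pq}\rangle,$$ where $\varphi_{pq},\psi_{pq}\colon A_p\to A_q$ are defined by $\varphi_{pq}(a)=qa$ and $\psi_{pq}(a)=q\backslash a$. Moreover, for all $p,q\in\mathrm{Id}^+\mathbf A$, $a\in A_p$ and $b\in A_q$, $$a\le b\iff\varphi_{ps}(a)\le_s\psi_{qs}(b),\quad\text{where } s=pq.$$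
   Context: A residuated poset is a structure $\mathbf A=\langle A,\le,\cdot,\backslash,/,1\rangle$ such that $\langle A,\le\rangle$ is a poset, $\langle A,\cdot,1\rangle$ is a monoid, and $x\cdot y\le z\iff x\le z/y\iff y\le x\backslash z$ for all $x,y,z\in A$. We write $xy$ for $x\cdot y$. It is balanced if $x\backslash x=x/x$ for all $x\in A$. Notation: $1_x:=x/x$. $\mathrm{Id}^+\mathbf A=\{p\in A: 1\le p,\ pp=p\}$; for $\mathbf A$ balanced, $\langle\mathrm{Id}^+\mathbf A,\cdot\rangle$ is a join semilattice with least element $1$ whose order is the restriction of that of $\mathbf A$. The component $\mathbf A_p$ ($p\in\mathrm{Id}^+\mathbf A$) is $\langle A_p,\le_p,\cdot_p,\backslash_p,/_p,p\rangle$, where $A_p=\{a\in A: a\backslash a=p\}$, the order and the (a priori partial) operations $\cdot_p,\backslash_p,/_p$ are the restrictions of those of $\mathbf A$, and the constant is $p$; under the hypotheses of the claim these sets are closed under $\cdot,\backslash,/$, so that each $\mathbf A_p$ has total operations. A metamorphism $f$ from $\mathbf A$ to $\mathbf B$ (algebras of the same type $\tau$) assigns to each $n$-ary symbol $\sigma$ of $\tau$ (constants included, $n=0$) a tuple $f^\sigma=\langle f^{\sigma0},\dots,f^{\sigma n}\rangle$ of maps $A\to B$ such that $f^{\sigma0}(\sigma^{\mathbf A}(a_1,\dots,a_n))=\sigma^{\mathbf B}(f^{\sigma1}(a_1),\dots,f^{\sigma n}(a_n))$ for all $a_1,\dots,a_n\in A$. Composition and identities are componentwise. A semilattice directed system of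 metamorphisms is a family $\{\xi_{pq}\text{ a metamorphism from }\mathbf A_p\text{ to }\mathbf A_q: p\le q\text{ in }\mathbf I\}$, indexed by a join semilattice $\mathbf I$ (with least element $\bot$ if $\tau$ has constants), with $\xi_{pp}$ the identity metamorphism and $\xi_{qr}\circ\xi_{pq}=\xi_{pr}$ for $p\le q\le r$. Its Płonka sum is the algebra on the disjoint union $\biguplus_pA_p$ with $\sigma(a_1,\dots,a_n)=\sigma^{\mathbf A_q}(\xi^{\sigma1}_{p_1q}(a_1),\dots,\xi^{\sigma n}_{p_nq}(a_n))$ for $a_k\in A_{p_k}$, $q=p_1\vee\dots\vee p_n$, and $\omega=\omega^{\mathbf A_\bot}$ for constant symbols $\omega$. Metamorphisms here are between the algebraic reducts (type $\cdot,\backslash,/,1$). -}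

module Defs where

open import Algebra.Core using (Op₂)
open import Algebra.Structures using (IsMonoid)
open import Data.Fin.Base using (Fin; zero; suc)
open import Data.Fin.Patterns using (0F; 1F; 2F)
open import Data.Nat.Base using (ℕ; zero; suc)
open import Data.Product.Base using (Σ; _×_; _,_; proj₁; proj₂)
open import Data.Product.Relation.Binary.Pointwise.Dependent as Pointwise using (_,_)
open import Data.Vec.Functional using (Vector; foldr)
open import Function.Base using (_∘_; _on_)
open import Function.Bundles using (_⇔_; Equivalence)
open import Function.Definitions using (Congruent; Bijective)
open import Level using (Level; _⊔_) renaming (suc to lsuc; zero to 0ℓ)
open import Relation.Binary.Bundles using (Setoid; Poset)
open import Relation.Binary.Core using (Rel)
open import Relation.Binary.Indexed.Heterogeneous using (IndexedSetoid)
open import Relation.Binary.Indexed.Heterogeneous.Construct.At using (_atₛ_)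
open import Relation.Binary.Lattice.Bundles using (BoundedJoinSemilattice)
import Relation.Binary.Lattice.Properties.JoinSemilattice as JoinSemilatticeProperties
open import Relation.Binary.Structures using (IsPartialOrder)

record Signature (o : Level) : Set (lsuc o) where
  field
    Symbol : Set o
    arity  : Symbol → ℕ

record Algebra {o} (τ : Signature o) (c ℓ : Level) : Set (o ⊔ lsuc (c ⊔ ℓ)) where
  open Signature τ
  field
    setoid : Setoid c ℓ
  open Setoid setoid public
  field
    ⟦_⟧    : ∀ σ → Vector Carrier (arity σ) → Carrier
    ⟦⟧-cong : ∀ σ {as bs : Vector Carrier (arity σ)} →
              (∀ k → as k ≈ bs k) → ⟦ σ ⟧ as ≈ ⟦ σ ⟧ bs

record IsIsomorphism {o c₁ ℓ₁ c₂ ℓ₂} {τ : Signature o}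
                     (A : Algebra τ c₁ ℓ₁) (B : Algebra τ c₂ ℓ₂)
                     (f : Algebra.Carrier A → Algebra.Carrier B)
                     : Set (o ⊔ c₁ ⊔ ℓ₁ ⊔ c₂ ⊔ ℓ₂) where
  private
    module A = Algebra A
    module B = Algebra B
  field
    cong      : Congruent A._≈_ B._≈_ f
    homo      : ∀ σ as → f (A.⟦ σ ⟧ as) B.≈ B.⟦ σ ⟧ (f ∘ as)
    bijective : Bijective A._≈_ B._≈_ f

-- A family of algebras indexed by the carrier of a setoid.  As in
-- `IndexedSetoid`, elements of different members may be compared, so
-- that members with equal indices can be identified with one another.

record IndexedAlgebra {o i} (τ : Signature o) (I : Set i) (c ℓ : Level)
                      : Set (o ⊔ lsuc (i ⊔ c ⊔ ℓ)) where
  open Signature τ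
  field
    indexedSetoid : IndexedSetoid I c ℓ
  open IndexedSetoid indexedSetoid public
  field
    ⟦_⟧    : ∀ σ {p} → Vector (Carrier p) (arity σ) → Carrier p
    ⟦⟧-cong : ∀ σ {p} {as bs : Vector (Carrier p) (arity σ)} →
              (∀ k → as k ≈ bs k) → ⟦ σ ⟧ as ≈ ⟦ σ ⟧ bs

  at : I → Algebra τ c ℓ
  at p = record
    { setoid  = indexedSetoid atₛ p
    ; ⟦_⟧     = λ σ → ⟦ σ ⟧
    ; ⟦⟧-cong = λ σ → ⟦⟧-cong σ
    }

module _ {o} {τ : Signature o} where
  open Signature τ

  -- The tuples ⟨f^σ0, …, f^σn⟩, one for each n-ary symbol σ.

  Tuples : ∀ {c₁ ℓ₁ c₂ ℓ₂} → Algebra τ c₁ ℓ₁ → Algebra τ c₂ ℓ₂ → Set (o ⊔ c₁ ⊔ c₂)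
  Tuples A B = ∀ σ → Fin (suc (arity σ)) → Algebra.Carrier A → Algebra.Carrier B

  record IsMetamorphism {c₁ ℓ₁ c₂ ℓ₂} (A : Algebra τ c₁ ℓ₁) (B : Algebra τ c₂ ℓ₂)
                        (f : Tuples A B) : Set (o ⊔ c₁ ⊔ ℓ₁ ⊔ ℓ₂) where
    private
      module A = Algebra A
      module B = Algebra B
    field
      cong : ∀ σ k → Congruent A._≈_ B._≈_ (f σ k)
      meta : ∀ σ as → f σ zero (A.⟦ σ ⟧ as) B.≈ B.⟦ σ ⟧ (λ k → f σ (suc k) (as k))

  idᵐ : ∀ {c ℓ} {A : Algebra τ c ℓ} → Tuples A A
  idᵐ σ k a = a

  infixr 9 _∘ᵐ_

  _∘ᵐ_ : ∀ {c₁ ℓ₁ c₂ ℓ₂ c₃ ℓ₃} {A : Algebra τ c₁ ℓ₁} {B : Algebra τ c₂ ℓ₂}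
         {C : Algebra τ c₃ ℓ₃} → Tuples B C → Tuples A B → Tuples A C
  (g ∘ᵐ f) σ k a = g σ k (f σ k a)

module _ {o i e r c ℓ} {τ : Signature o} (I : BoundedJoinSemilattice i e r)
         (𝔸 : IndexedAlgebra τ (BoundedJoinSemilattice.Carrier I) c ℓ) where
  open Signature τ
  private
    module I = BoundedJoinSemilattice I
    module 𝔸 = IndexedAlgebra 𝔸
  open I using (_≤_; _∨_; ⊥)

  -- `identity` says that ξ_pp is the identity metamorphism; as equality
  -- of indices is a setoid equality, it has to be imposed on ξ_pq
  -- whenever p ≈ q.

  record IsDirectedSystem (ξ : ∀ {p q} → p ≤ q → Tuples (𝔸.at p) (𝔸.at q))
                          : Set (o ⊔ i ⊔ e ⊔ r ⊔ c ⊔ ℓ) where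
    field
      isMetamorphism : ∀ {p q} (p≤q : p ≤ q) → IsMetamorphism (𝔸.at p) (𝔸.at q) (ξ p≤q)
      identity       : ∀ {p q} → p I.≈ q → (p≤q : p ≤ q) →
                       ∀ σ k a → ξ p≤q σ k a 𝔸.≈ idᵐ {A = 𝔸.at p} σ k a
      composition    : ∀ {p q r} (p≤q : p ≤ q) (q≤r : q ≤ r) (p≤r : p ≤ r) →
                       ∀ σ k a →
                       _∘ᵐ_ {A = 𝔸.at p} {𝔸.at q} {𝔸.at r} (ξ q≤r) (ξ p≤q) σ k a
                       𝔸.≈ ξ p≤r σ k a

  -- The join of the empty family is ⊥, which accounts for the constants.

  ⋁ : ∀ {n} → Vector I.Carrier n → I.Carrier
  ⋁ = foldr _∨_ ⊥

  ≤⋁ : ∀ {n} (ps : Vector I.Carrier n) k → ps k ≤ ⋁ ps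
  ≤⋁ ps zero    = I.x≤x∨y _ _
  ≤⋁ ps (suc k) = I.trans (≤⋁ (ps ∘ suc) k) (I.y≤x∨y _ _)

  private
    ⋁-cong : ∀ {n} {ps qs : Vector I.Carrier n} →
             (∀ k → ps k I.≈ qs k) → ⋁ ps I.≈ ⋁ qs
    ⋁-cong {zero}  ps≈qs = I.Eq.refl
    ⋁-cong {suc n} ps≈qs = ∨-cong (ps≈qs zero) (⋁-cong (ps≈qs ∘ suc))
      where open JoinSemilatticeProperties I.joinSemilattice using (∨-cong)

  module _ {ξ : ∀ {p q} → p ≤ q → Tuples (𝔸.at p) (𝔸.at q)}
           (isDirectedSystem : IsDirectedSystem ξ) where
    open IsDirectedSystem isDirectedSystem

    private
      ξ-cong : ∀ {p q p′ q′} → p I.≈ p′ → q I.≈ q′ → (p≤q : p ≤ q) (p′≤q′ : p′ ≤ q′) →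
               ∀ σ k {a a′} → a 𝔸.≈ a′ → ξ p≤q σ k a 𝔸.≈ ξ p′≤q′ σ k a′
      ξ-cong p≈p′ q≈q′ p≤q p′≤q′ σ k {a} {a′} a≈a′ =
        𝔸.trans (𝔸.sym (identity q≈q′ q≤q′ σ k _))
        (𝔸.trans (composition p≤q q≤q′ p≤q′ σ k a)
        (𝔸.trans (𝔸.sym (composition p≤p′ p′≤q′ p≤q′ σ k a))
        (IsMetamorphism.cong (isMetamorphism p′≤q′) σ k
          (𝔸.trans (identity p≈p′ p≤p′ σ k a) a≈a′))))
        where
        p≤p′ = I.reflexive p≈p′
        q≤q′ = I.reflexive q≈q′
        p≤q′ = I.trans p≤q q≤q′

      ⟦⟧-cong′ : ∀ σ {q q′} → q I.≈ q′ →
                 {as : Vector (𝔸.Carrier q) (arity σ)} {bs : Vector (𝔸.Carrier q′) (arity σ)} →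
                 (∀ k → as k 𝔸.≈ bs k) → 𝔸.⟦ σ ⟧ as 𝔸.≈ 𝔸.⟦ σ ⟧ bs
      ⟦⟧-cong′ σ q≈q′ as≈bs =
        𝔸.trans (𝔸.sym (identity q≈q′ q≤q′ σ zero _))
        (𝔸.trans (IsMetamorphism.meta (isMetamorphism q≤q′) σ _)
        (𝔸.⟦⟧-cong σ (λ k → 𝔸.trans (identity q≈q′ q≤q′ σ (suc k) _) (as≈bs k))))
        where q≤q′ = I.reflexive q≈q′

    PłonkaSum : Algebra τ (i ⊔ c) (i ⊔ e ⊔ c ⊔ ℓ)
    PłonkaSum = record
      { setoid  = Pointwise.setoid (Poset.Eq.setoid I.poset) 𝔸.indexedSetoid
      ; ⟦_⟧     = λ σ as → let ps = proj₁ ∘ as in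
                  ⋁ ps , 𝔸.⟦ σ ⟧ (λ k → ξ (≤⋁ ps k) σ (suc k) (proj₂ (as k)))
      ; ⟦⟧-cong = λ σ as≈bs → let q≈q′ = ⋁-cong (λ k → Pointwise.proj₁ (as≈bs k)) in
                  q≈q′ , ⟦⟧-cong′ σ q≈q′ (λ k →
                    ξ-cong (Pointwise.proj₁ (as≈bs k)) q≈q′ (≤⋁ _ k) (≤⋁ _ k) σ (suc k)
                      (Pointwise.proj₂ (as≈bs k)))
      }

data ResiduatedSymbol : Set where
  mul ldiv rdiv one : ResiduatedSymbol

residuatedSignature : Signature 0ℓ
residuatedSignature = record
  { Symbol = ResiduatedSymbol
  ; arity  = λ { mul → 2 ; ldiv → 2 ; rdiv → 2 ; one → 0 }
  }

interpret : ∀ {c} {X : Set c} (_·_ _\\_ _//_ : Op₂ X) (1# : X) →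
            ∀ σ → Vector X (Signature.arity residuatedSignature σ) → X
interpret _·_ _\\_ _//_ 1# mul  as = as 0F · as 1F
interpret _·_ _\\_ _//_ 1# ldiv as = as 0F \\ as 1F
interpret _·_ _\\_ _//_ 1# rdiv as = as 0F // as 1F
interpret _·_ _\\_ _//_ 1# one  as = 1#

record ResiduatedPoset (c ℓ₁ ℓ₂ : Level) : Set (lsuc (c ⊔ ℓ₁ ⊔ ℓ₂)) where
  infix  4 _≈_ _≤_
  infixl 7 _·_ _//_
  infixr 7 _\\_
  field
    Carrier        : Set c
    _≈_            : Rel Carrier ℓ₁
    _≤_            : Rel Carrier ℓ₂
    _·_            : Op₂ Carrier
    _\\_           : Op₂ Carrier
    _//_           : Op₂ Carrier
    1#             : Carrier
    isPartialOrder : IsPartialOrder _≈_ _≤_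
    isMonoid       : IsMonoid _≈_ _·_ 1#
    residuation    : ∀ x y z → (x · y ≤ z ⇔ x ≤ z // y) × (x ≤ z // y ⇔ y ≤ x \\ z)

  open IsPartialOrder isPartialOrder public
    using (module Eq; antisym)
    renaming (refl to ≤-refl; reflexive to ≤-reflexive; trans to ≤-trans)
  open IsMonoid isMonoid public
    using (assoc; identityˡ; identityʳ) renaming (∙-cong to ·-cong)

  1[_] : Carrier → Carrier
  1[ x ] = x // x

  Balanced : Set (c ⊔ ℓ₁)
  Balanced = ∀ x → x \\ x ≈ x // x

  ·≤⇒≤// : ∀ {x y z} → x · y ≤ z → x ≤ z // y
  ·≤⇒≤// = Equivalence.to (proj₁ (residuation _ _ _))

  ≤//⇒·≤ : ∀ {x y z} → x ≤ z // y → x · y ≤ z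
  ≤//⇒·≤ = Equivalence.from (proj₁ (residuation _ _ _))

  ·≤⇒≤\\ : ∀ {x y z} → x · y ≤ z → y ≤ x \\ z
  ·≤⇒≤\\ = Equivalence.to (proj₂ (residuation _ _ _)) ∘ ·≤⇒≤//

  ≤\\⇒·≤ : ∀ {x y z} → y ≤ x \\ z → x · y ≤ z
  ≤\\⇒·≤ = ≤//⇒·≤ ∘ Equivalence.from (proj₂ (residuation _ _ _))

  ·-monoˡ : ∀ {x y} z → x ≤ y → x · z ≤ y · z
  ·-monoˡ z x≤y = ≤//⇒·≤ (≤-trans x≤y (·≤⇒≤// ≤-refl))

  ·-monoʳ : ∀ {x y} z → x ≤ y → z · x ≤ z · y
  ·-monoʳ z x≤y = ≤\\⇒·≤ (≤-trans x≤y (·≤⇒≤\\ ≤-refl))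

  ·-mono : ∀ {x y u v} → x ≤ y → u ≤ v → x · u ≤ y · v
  ·-mono {y = y} {u} x≤y u≤v = ≤-trans (·-monoˡ u x≤y) (·-monoʳ y u≤v)

  private
    \\-mono : ∀ {x y u v} → y ≤ x → u ≤ v → x \\ u ≤ y \\ v
    \\-mono y≤x u≤v = ·≤⇒≤\\ (≤-trans (·-monoˡ _ y≤x) (≤-trans (≤\\⇒·≤ ≤-refl) u≤v))

    //-mono : ∀ {x y u v} → x ≤ y → v ≤ u → x // u ≤ y // v
    //-mono x≤y v≤u = ·≤⇒≤// (≤-trans (·-monoʳ _ v≤u) (≤-trans (≤//⇒·≤ ≤-refl) x≤y))

  \\-cong : ∀ {x y u v} → x ≈ y → u ≈ v → x \\ u ≈ y \\ v
  \\-cong x≈y u≈v = antisym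
    (\\-mono (≤-reflexive (Eq.sym x≈y)) (≤-reflexive u≈v))
    (\\-mono (≤-reflexive x≈y) (≤-reflexive (Eq.sym u≈v)))

  //-cong : ∀ {x y u v} → x ≈ y → u ≈ v → x // u ≈ y // v
  //-cong x≈y u≈v = antisym
    (//-mono (≤-reflexive x≈y) (≤-reflexive (Eq.sym u≈v)))
    (//-mono (≤-reflexive (Eq.sym x≈y)) (≤-reflexive u≈v))

  algebraicReduct : Algebra residuatedSignature c ℓ₁
  algebraicReduct = record
    { setoid  = record { isEquivalence = IsPartialOrder.isEquivalence isPartialOrder }
    ; ⟦_⟧     = interpret _·_ _\\_ _//_ 1#
    ; ⟦⟧-cong = λ { mul  as≈bs → ·-cong (as≈bs 0F) (as≈bs 1F)
                  ; ldiv as≈bs → \\-cong (as≈bs 0F) (as≈bs 1F)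
                  ; rdiv as≈bs → //-cong (as≈bs 0F) (as≈bs 1F)
                  ; one  as≈bs → Eq.refl
                  }
    }

  record PositiveIdempotent : Set (c ⊔ ℓ₁ ⊔ ℓ₂) where
    field
      elem       : Carrier
      positive   : 1# ≤ elem
      idempotent : elem · elem ≈ elem

    elem\\elem≈elem : elem \\ elem ≈ elem
    elem\\elem≈elem = antisym
      (≤-trans (≤-reflexive (Eq.sym (identityˡ _)))
        (≤-trans (·-monoˡ _ positive) (≤\\⇒·≤ ≤-refl)))
      (·≤⇒≤\\ (≤-reflexive idempotent))

  open PositiveIdempotent using (elem; positive; idempotent; elem\\elem≈elem)

  -- A_p; membership proofs are ignored when elements are compared.

  record Component (p : PositiveIdempotent) : Set (c ⊔ ℓ₁) where
    constructor _,_
    field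
      value  : Carrier
      \\-self : value \\ value ≈ elem p

  open Component using (value; \\-self)

  infix 4 _≤ᶜ_

  _≤ᶜ_ : ∀ {p} → Rel (Component p) ℓ₂
  a ≤ᶜ b = value a ≤ value b

module _ {c ℓ₁ ℓ₂} (A : ResiduatedPoset c ℓ₁ ℓ₂)
         (balanced : ResiduatedPoset.Balanced A) where
  open ResiduatedPoset A
  open PositiveIdempotent

  private
    x≤x·p : ∀ x p → 1# ≤ p → x ≤ x · p
    x≤x·p x p 1≤p = ≤-trans (≤-reflexive (Eq.sym (identityʳ x))) (·-monoʳ x 1≤p)

    x≤p·x : ∀ x p → 1# ≤ p → x ≤ p · x
    x≤p·x x p 1≤p = ≤-trans (≤-reflexive (Eq.sym (identityˡ x))) (·-monoˡ x 1≤p)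

    join : Op₂ PositiveIdempotent
    join p q = record
      { elem       = r
      ; positive   = 1≤r
      ; idempotent = antisym rr≤r (x≤x·p r r 1≤r)
      }
      where
      r = elem p · elem q

      1≤r : 1# ≤ r
      1≤r = ≤-trans (positive p) (x≤x·p _ _ (positive q))

      pr≤r : elem p · r ≤ r
      pr≤r = ≤-trans (≤-reflexive (Eq.sym (assoc _ _ _)))
                     (·-monoˡ _ (≤-reflexive (idempotent p)))

      rp≤r : r · elem p ≤ r
      rp≤r = ≤\\⇒·≤ (≤-trans (·≤⇒≤// pr≤r) (≤-reflexive (Eq.sym (balanced r))))

      rr≤r : r · r ≤ r
      rr≤r = ≤-trans (≤-reflexive (Eq.sym (assoc _ _ _)))
             (≤-trans (·-monoˡ _ rp≤r)
             (≤-trans (≤-reflexive (assoc _ _ _))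
                      (·-monoʳ _ (≤-reflexive (idempotent q)))))

  Id⁺ : BoundedJoinSemilattice (c ⊔ ℓ₁ ⊔ ℓ₂) ℓ₁ ℓ₂
  Id⁺ = record
    { Carrier = PositiveIdempotent
    ; _≈_     = _≈_ on elem
    ; _≤_     = _≤_ on elem
    ; _∨_     = join
    ; ⊥       = record { elem = 1# ; positive = ≤-refl ; idempotent = identityˡ 1# }
    ; isBoundedJoinSemilattice = record
      { isJoinSemilattice = record
        { isPartialOrder = record
          { isPreorder = record
            { isEquivalence = record { refl = Eq.refl ; sym = Eq.sym ; trans = Eq.trans }
            ; reflexive     = ≤-reflexive
            ; trans         = ≤-trans
            }
          ; antisym = antisym
          }
        ; supremum = λ p q →
            x≤x·p (elem p) (elem q) (positive q)
          , x≤p·x (elem q) (elem p) (positive p)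
          , λ r p≤r q≤r → ≤-trans (·-mono p≤r q≤r) (≤-reflexive (idempotent r))
        }
      ; minimum = positive
      }
    }

module _ {c ℓ₁ ℓ₂} (A : ResiduatedPoset c ℓ₁ ℓ₂) where
  open ResiduatedPoset A

  module Decomposition
    (balanced : Balanced)
    (1-·  : ∀ x y → 1[ x ] · 1[ y ] ≈ 1[ x · y ])
    (1-\\ : ∀ x y → 1[ x \\ y ] ≈ 1[ x ] · 1[ y ])
    (1-// : ∀ x y → 1[ x // y ] ≈ 1[ x ] · 1[ y ])
    where

    open PositiveIdempotent
    open Component
    open BoundedJoinSemilattice (Id⁺ A balanced) public
      using () renaming (_≤_ to _≤⁺_; _∨_ to _∨⁺_; x≤x∨y to p≤p∨q; y≤x∨y to q≤p∨q)

    private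
      1[value] : ∀ {p} (a : Component p) → 1[ value a ] ≈ elem p
      1[value] a = Eq.trans (Eq.sym (balanced _)) (\\-self a)

      component : ∀ p x → 1[ x ] ≈ elem p → Component p
      component p x 1x≈p = x , Eq.trans (balanced x) 1x≈p

      self : ∀ p → Component p
      self p = elem p , elem\\elem≈elem p

      ≤⇒·≈ : ∀ {p q} → p ≤⁺ q → elem q · elem p ≈ elem q
      ≤⇒·≈ {p} {q} p≤q = antisym
        (≤-trans (·-monoʳ _ p≤q) (≤-reflexive (idempotent q)))
        (p≤p∨q q p)

    infixl 7 _·ᶜ_ _//ᶜ_
    infixr 7 _\\ᶜ_

    _·ᶜ_ _\\ᶜ_ _//ᶜ_ : ∀ {p} → Op₂ (Component p)
    _·ᶜ_ {p} a b = component p (value a · value b)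
      (Eq.trans (Eq.sym (1-· _ _)) (Eq.trans (·-cong (1[value] a) (1[value] b)) (idempotent p)))
    _\\ᶜ_ {p} a b = component p (value a \\ value b)
      (Eq.trans (1-\\ _ _) (Eq.trans (·-cong (1[value] a) (1[value] b)) (idempotent p)))
    _//ᶜ_ {p} a b = component p (value a // value b)
      (Eq.trans (1-// _ _) (Eq.trans (·-cong (1[value] a) (1[value] b)) (idempotent p)))

    components : IndexedAlgebra residuatedSignature PositiveIdempotent (c ⊔ ℓ₁) ℓ₁
    components = record
      { indexedSetoid = record
        { Carrier       = Component
        ; _≈_           = λ a b → value a ≈ value b
        ; isEquivalence = record { refl = Eq.refl ; sym = Eq.sym ; trans = Eq.trans }
        }
      ; ⟦_⟧     = λ σ {p} → interpret _·ᶜ_ _\\ᶜ_ _//ᶜ_ (self p) σ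
      ; ⟦⟧-cong = λ { mul  as≈bs → ·-cong (as≈bs 0F) (as≈bs 1F)
                    ; ldiv as≈bs → \\-cong (as≈bs 0F) (as≈bs 1F)
                    ; rdiv as≈bs → //-cong (as≈bs 0F) (as≈bs 1F)
                    ; one  as≈bs → Eq.refl
                    }
      }

    φ ψ : ∀ {p q} → p ≤⁺ q → Component p → Component q
    φ {p} {q} p≤q a = component q (elem q · value a)
      (Eq.trans (Eq.sym (1-· _ _))
        (Eq.trans (·-cong (1[value] (self q)) (1[value] a)) (≤⇒·≈ {p} {q} p≤q)))
    ψ {p} {q} p≤q a = component q (elem q \\ value a)
      (Eq.trans (1-\\ _ _)
        (Eq.trans (·-cong (1[value] (self q)) (1[value] a)) (≤⇒·≈ {p} {q} p≤q)))

    ξ : ∀ {p q} → p ≤⁺ q →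
        Tuples (IndexedAlgebra.at components p) (IndexedAlgebra.at components q)
    ξ p≤q one  0F = φ p≤q
    ξ p≤q mul  0F = φ p≤q
    ξ p≤q mul  1F = φ p≤q
    ξ p≤q mul  2F = φ p≤q
    ξ p≤q ldiv 0F = ψ p≤q
    ξ p≤q ldiv 1F = φ p≤q
    ξ p≤q ldiv 2F = ψ p≤q
    ξ p≤q rdiv 0F = ψ p≤q
    ξ p≤q rdiv 1F = ψ p≤q
    ξ p≤q rdiv 2F = φ p≤q

{-# OPTIONS --safe #-}
module Submission where

open import Data.Fin.Patterns using (0F; 1F; 2F)
open import Data.Product.Base using (Σ-syntax; _×_; _,_; proj₁; proj₂)
open import Data.Product.Relation.Binary.Pointwise.Dependent using (_,_)
open import Function.Base using (_∘_)
open import Function.Bundles using (_⇔_; mk⇔)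
open import Relation.Binary.Bundles using (Poset)
import Relation.Binary.Reasoning.PartialOrder as PosetReasoning
import Relation.Binary.Reasoning.Setoid as SetoidReasoning
open import Defs

-- In a balanced residuated poset px ≤ x iff xp ≤ x, and this makes every
-- positive idempotent q central.  Hence x ↦ qx and x ↦ q\x satisfy the
-- metamorphism identities on all of A.  They are the identity on the x with
-- 1ₓ = q, and the hypotheses on 1ₓ say that the operations of A land in the
-- component indexed by the join, so that the Płonka sum recovers them.

-- Residuation identities and the idempotents `1[ x ]`.

module ResiduatedPosetProperties {c ℓ₁ ℓ₂} (A : ResiduatedPoset c ℓ₁ ℓ₂) where
  open ResiduatedPoset A

  poset : Poset c ℓ₁ ℓ₂
  poset = record { isPartialOrder = isPartialOrder }

  open PosetReasoning poset

  \\-counit : ∀ x y → x · (x \\ y) ≤ y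
  \\-counit x y = ≤\\⇒·≤ ≤-refl

  //-counit : ∀ x y → (x // y) · y ≤ x
  //-counit x y = ≤//⇒·≤ ≤-refl

  \\-curry : ∀ x y z → x \\ (y \\ z) ≈ (y · x) \\ z
  \\-curry x y z = antisym
    (·≤⇒≤\\ (≤-trans (≤-reflexive (assoc _ _ _)) (≤\\⇒·≤ (\\-counit x (y \\ z)))))
    (·≤⇒≤\\ (·≤⇒≤\\ (≤-trans (≤-reflexive (Eq.sym (assoc _ _ _))) (\\-counit (y · x) z))))

  //-curry : ∀ x y z → (x // y) // z ≈ x // (z · y)
  //-curry x y z = antisym
    (·≤⇒≤// (≤-trans (≤-reflexive (Eq.sym (assoc _ _ _))) (≤//⇒·≤ (//-counit (x // y) z))))
    (·≤⇒≤// (·≤⇒≤// (≤-trans (≤-reflexive (assoc _ _ _)) (//-counit x (z · y)))))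

  \\-//-assoc : ∀ x y z → (x \\ y) // z ≈ x \\ (y // z)
  \\-//-assoc x y z = antisym
    (·≤⇒≤\\ (·≤⇒≤// (≤-trans (≤-reflexive (assoc _ _ _)) (≤\\⇒·≤ (//-counit (x \\ y) z)))))
    (·≤⇒≤// (·≤⇒≤\\ (≤-trans (≤-reflexive (Eq.sym (assoc _ _ _))) (≤//⇒·≤ (\\-counit x (y // z))))))

  x≤p·x : ∀ {p} x → 1# ≤ p → x ≤ p · x
  x≤p·x x 1≤p = ≤-trans (≤-reflexive (Eq.sym (identityˡ x))) (·-monoˡ x 1≤p)

  x≤x·p : ∀ {p} x → 1# ≤ p → x ≤ x · p
  x≤x·p x 1≤p = ≤-trans (≤-reflexive (Eq.sym (identityʳ x))) (·-monoʳ x 1≤p)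

  1≤1[_] : ∀ x → 1# ≤ 1[ x ]
  1≤1[ x ] = ·≤⇒≤// (≤-reflexive (identityˡ x))

  1[x]·x≈x : ∀ x → 1[ x ] · x ≈ x
  1[x]·x≈x x = antisym (//-counit x x) (x≤p·x x 1≤1[ x ])

  1[x]\\x≈x : ∀ x → 1[ x ] \\ x ≈ x
  1[x]\\x≈x x = antisym
    (≤-trans (x≤p·x _ 1≤1[ x ]) (\\-counit _ x))
    (·≤⇒≤\\ (//-counit x x))

  -- The index of the component that will contain `x`. It is idempotent because `1[ x ]` fixes `x`,
  -- hence so does its square, which therefore lies below `x // x`.
  1⁺[_] : Carrier → PositiveIdempotent
  1⁺[ x ] = record
    { elem       = 1[ x ]
    ; positive   = 1≤1[ x ]
    ; idempotent = antisym
        (·≤⇒≤// (begin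
          1[ x ] · 1[ x ] · x    ≈⟨ assoc _ _ _ ⟩
          1[ x ] · (1[ x ] · x)  ≈⟨ ·-cong Eq.refl (1[x]·x≈x x) ⟩
          1[ x ] · x             ≤⟨ //-counit x x ⟩
          x                      ∎))
        (x≤p·x _ 1≤1[ x ])
    }

  module _ {x p} (1x≈p : 1[ x ] ≈ p) where

    -- The index enters only up to `≈`, so that `p` may be instantiated with a join of indices that
    -- is merely equal to `1[ x ]`.
    absorb-· : p · x ≈ x
    absorb-· = Eq.trans (·-cong (Eq.sym 1x≈p) Eq.refl) (1[x]·x≈x x)

    absorb-\\ : p \\ x ≈ x
    absorb-\\ = Eq.trans (\\-cong (Eq.sym 1x≈p) Eq.refl) (1[x]\\x≈x x)

-- Centrality of positive idempotents, and the metamorphism identities.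

module BalancedProperties {c ℓ₁ ℓ₂} (A : ResiduatedPoset c ℓ₁ ℓ₂)
                          (balanced : ResiduatedPoset.Balanced A) where
  open ResiduatedPoset A
  open ResiduatedPosetProperties A
  open SetoidReasoning (Poset.Eq.setoid poset)

  -- By residuation the two inequalities bound `p` by the right and by the left self-residual of
  -- `x`; balance equates these bounds.
  px≤x⇒xp≤x : ∀ {p x} → p · x ≤ x → x · p ≤ x
  px≤x⇒xp≤x px≤x = ≤\\⇒·≤ (≤-trans (·≤⇒≤// px≤x) (≤-reflexive (Eq.sym (balanced _))))

  xp≤x⇒px≤x : ∀ {p x} → x · p ≤ x → p · x ≤ x
  xp≤x⇒px≤x xp≤x = ≤//⇒·≤ (≤-trans (·≤⇒≤\\ xp≤x) (≤-reflexive (balanced _)))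

  module _ (p⁺ : PositiveIdempotent) where
    open PositiveIdempotent p⁺ renaming (elem to p)

    ·-absorbˡ : ∀ x → p · (p · x) ≈ p · x
    ·-absorbˡ x = Eq.trans (Eq.sym (assoc p p x)) (·-cong idempotent Eq.refl)

    ·-absorbʳ : ∀ x → (x · p) · p ≈ x · p
    ·-absorbʳ x = Eq.trans (assoc x p p) (·-cong Eq.refl idempotent)

    -- Idempotence gives `(x · p) · p ≤ x · p`; switching sides gives `p · (x · p) ≤ x · p`, and
    -- `p · x` lies below the left-hand side by positivity. The other inequality is the mirror
    -- image.
    central : ∀ x → p · x ≈ x · p
    central x = antisym
      (≤-trans (·-monoʳ p (x≤x·p x positive)) (xp≤x⇒px≤x (≤-reflexive (·-absorbʳ x))))
      (≤-trans (·-monoˡ p (x≤p·x x positive)) (px≤x⇒xp≤x (≤-reflexive (·-absorbˡ x))))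

    -- Left and right multiplication by `p` are the same map, so their residuals agree.
    \\≈// : ∀ x → p \\ x ≈ x // p
    \\≈// x = antisym
      (·≤⇒≤// (≤-trans (≤-reflexive (Eq.sym (central _))) (\\-counit p x)))
      (·≤⇒≤\\ (≤-trans (≤-reflexive (central _)) (//-counit x p)))

    -- Idempotence supplies a second `p`, and centrality carries it past `x`.
    distrib-· : ∀ x y → p · (x · y) ≈ (p · x) · (p · y)
    distrib-· x y = begin
      p · (x · y)        ≈⟨ ·-absorbˡ _ ⟨
      p · (p · (x · y))  ≈⟨ ·-cong Eq.refl (assoc p x y) ⟨
      p · ((p · x) · y)  ≈⟨ assoc p (p · x) y ⟨
      (p · (p · x)) · y  ≈⟨ ·-cong (central (p · x)) Eq.refl ⟩
      ((p · x) · p) · y  ≈⟨ assoc (p · x) p y ⟩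
      (p · x) · (p · y)  ∎

    -- Currying moves `p` into the denominator, where idempotence doubles it; one copy stays there
    -- as a multiplier and the other is curried back onto the numerator. This is why denominators
    -- are mapped by `φ` and numerators by `ψ`.
    distrib-\\ : ∀ x y → p \\ (x \\ y) ≈ (p · x) \\ (p \\ y)
    distrib-\\ x y = begin
      p \\ (x \\ y)        ≈⟨ \\-curry p x y ⟩
      (x · p) \\ y         ≈⟨ \\-cong (central x) Eq.refl ⟨
      (p · x) \\ y         ≈⟨ \\-cong (·-absorbˡ x) Eq.refl ⟨
      (p · (p · x)) \\ y   ≈⟨ \\-curry (p · x) p y ⟨
      (p · x) \\ (p \\ y)  ∎

    -- The same doubling in the denominator, after the left division by `p` has been turned into a
    -- right division so that it can be curried with `y`.
    distrib-// : ∀ x y → p \\ (x // y) ≈ (p \\ x) // (p · y)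
    distrib-// x y = begin
      p \\ (x // y)          ≈⟨ \\-//-assoc p x y ⟨
      (p \\ x) // y          ≈⟨ //-cong (\\≈// x) Eq.refl ⟩
      (x // p) // y          ≈⟨ //-curry x p y ⟩
      x // (y · p)           ≈⟨ //-cong Eq.refl (·-absorbʳ y) ⟨
      x // ((y · p) · p)     ≈⟨ //-curry x p (y · p) ⟨
      (x // p) // (y · p)    ≈⟨ //-cong (\\≈// x) (central y) ⟨
      (p \\ x) // (p · y)    ∎

-- The directed system, the isomorphism and the order.

module PłonkaDecomposition {c ℓ₁ ℓ₂} (A : ResiduatedPoset c ℓ₁ ℓ₂) where
  open ResiduatedPoset A

  module _
    (balanced : Balanced)
    (1-·  : ∀ x y → 1[ x ] · 1[ y ] ≈ 1[ x · y ])
    (1-\\ : ∀ x y → 1[ x \\ y ] ≈ 1[ x ] · 1[ y ])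
    (1-// : ∀ x y → 1[ x // y ] ≈ 1[ x ] · 1[ y ])
    where

    open ResiduatedPosetProperties A
    open BalancedProperties A balanced
    open Decomposition A balanced 1-· 1-\\ 1-//
    open PositiveIdempotent
    open Component

    1[value] : ∀ {p} (a : Component p) → 1[ value a ] ≈ elem p
    1[value] a = Eq.trans (Eq.sym (balanced _)) (\\-self a)

    ≤⇒q·p≈q : ∀ p q → p ≤⁺ q → elem q · elem p ≈ elem q
    ≤⇒q·p≈q p q p≤q = antisym
      (≤-trans (·-monoʳ _ p≤q) (≤-reflexive (idempotent q)))
      (p≤p∨q q p)

    ≤⇒p·q≈q : ∀ p q → p ≤⁺ q → elem p · elem q ≈ elem q
    ≤⇒p·q≈q p q p≤q = Eq.trans (central p _) (≤⇒q·p≈q p q p≤q)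

    φ-identity : ∀ {p q} → elem p ≈ elem q → (a : Component p) → elem q · value a ≈ value a
    φ-identity p≈q a = absorb-· (Eq.trans (1[value] a) p≈q)

    ψ-identity : ∀ {p q} → elem p ≈ elem q → (a : Component p) → elem q \\ value a ≈ value a
    ψ-identity p≈q a = absorb-\\ (Eq.trans (1[value] a) p≈q)

    φ-composition : ∀ q r → q ≤⁺ r → ∀ x → elem r · (elem q · x) ≈ elem r · x
    φ-composition q r q≤r x =
      Eq.trans (Eq.sym (assoc _ _ _)) (·-cong (≤⇒q·p≈q q r q≤r) Eq.refl)

    -- Currying reverses the factors, so the product to collapse is `q · r`; this is where the
    -- centrality inside `≤⇒p·q≈q` enters.
    ψ-composition : ∀ q r → q ≤⁺ r → ∀ x → elem r \\ (elem q \\ x) ≈ elem r \\ x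
    ψ-composition q r q≤r x =
      Eq.trans (\\-curry _ _ x) (\\-cong (≤⇒p·q≈q q r q≤r) Eq.refl)

    isDirectedSystem : IsDirectedSystem (Id⁺ A balanced) components ξ
    isDirectedSystem = record
      { isMetamorphism = λ {p} {q} p≤q → record
        { cong = λ
          { one  0F → ·-cong Eq.refl
          ; mul  0F → ·-cong Eq.refl
          ; mul  1F → ·-cong Eq.refl
          ; mul  2F → ·-cong Eq.refl
          ; ldiv 0F → \\-cong Eq.refl
          ; ldiv 1F → ·-cong Eq.refl
          ; ldiv 2F → \\-cong Eq.refl
          ; rdiv 0F → \\-cong Eq.refl
          ; rdiv 1F → \\-cong Eq.refl
          ; rdiv 2F → ·-cong Eq.refl
          }
        ; meta = λ
          -- The constant of the component at `p` is `p` itself, and `φ` sends it to `q · p`.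
          { one  as → ≤⇒q·p≈q p q p≤q
          ; mul  as → distrib-· q _ _
          ; ldiv as → distrib-\\ q _ _
          ; rdiv as → distrib-// q _ _
          }
        }
      ; identity = λ {p} {q} p≈q p≤q → λ
        { one  0F → φ-identity {p} {q} p≈q
        ; mul  0F → φ-identity {p} {q} p≈q
        ; mul  1F → φ-identity {p} {q} p≈q
        ; mul  2F → φ-identity {p} {q} p≈q
        ; ldiv 0F → ψ-identity {p} {q} p≈q
        ; ldiv 1F → φ-identity {p} {q} p≈q
        ; ldiv 2F → ψ-identity {p} {q} p≈q
        ; rdiv 0F → ψ-identity {p} {q} p≈q
        ; rdiv 1F → ψ-identity {p} {q} p≈q
        ; rdiv 2F → φ-identity {p} {q} p≈q
        }
      ; composition = λ {_} {q} {r} _ q≤r _ → λ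
        { one  0F a → φ-composition q r q≤r (value a)
        ; mul  0F a → φ-composition q r q≤r (value a)
        ; mul  1F a → φ-composition q r q≤r (value a)
        ; mul  2F a → φ-composition q r q≤r (value a)
        ; ldiv 0F a → ψ-composition q r q≤r (value a)
        ; ldiv 1F a → φ-composition q r q≤r (value a)
        ; ldiv 2F a → ψ-composition q r q≤r (value a)
        ; rdiv 0F a → ψ-composition q r q≤r (value a)
        ; rdiv 1F a → ψ-composition q r q≤r (value a)
        ; rdiv 2F a → φ-composition q r q≤r (value a)
        }
      }

    -- The extra factor 1# is the ⊥ at the end of the fold defining ⋁.
    1[value]·1[value] : ∀ {p q} (a : Component p) (b : Component q) →
                        1[ value a ] · 1[ value b ] ≈ elem p · (elem q · 1#)
    1[value]·1[value] a b =
      ·-cong (1[value] a) (Eq.trans (1[value] b) (Eq.sym (identityʳ _)))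

    isIsomorphism : IsIsomorphism (PłonkaSum (Id⁺ A balanced) components isDirectedSystem)
                                  algebraicReduct (λ x → value (proj₂ x))
    isIsomorphism = record
      { cong = λ { (_ , a≈b) → a≈b }
      ; homo = λ
        -- In each binary case the distributive law, read backwards, pulls the join `s` out of the
        -- arguments; the hypothesis on `1[_]` places the result in the component at `s`, so `s` is
        -- absorbed.
        { mul  as → Eq.trans (Eq.sym (distrib-· (s as) _ _))
            (absorb-· (Eq.trans (Eq.sym (1-· _ _)) (1≈s as)))
        ; ldiv as → Eq.trans (Eq.sym (distrib-\\ (s as) _ _))
            (absorb-\\ (Eq.trans (1-\\ _ _) (1≈s as)))
        ; rdiv as → Eq.trans (Eq.sym (distrib-// (s as) _ _))
            (absorb-\\ (Eq.trans (1-// _ _) (1≈s as)))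
        ; one  as → Eq.refl
        }
      ; bijective =
          -- Injectivity: the index is recovered from the value as `1[ value a ]`.
          (λ { {p , a} {q , b} a≈b →
               Eq.trans (Eq.sym (1[value] a)) (Eq.trans (//-cong a≈b a≈b) (1[value] b)) , a≈b })
        , (λ x → (1⁺[ x ] , (x , balanced x)) , λ { (_ , a≈x) → a≈x })
      }
      where
      s : (_ → Σ[ p ∈ PositiveIdempotent ] Component p) → PositiveIdempotent
      s as = ⋁ (Id⁺ A balanced) components {n = 2} (proj₁ ∘ as)

      1≈s : ∀ as → 1[ value (proj₂ (as 0F)) ] · 1[ value (proj₂ (as 1F)) ] ≈ elem (s as)
      1≈s as = 1[value]·1[value] (proj₂ (as 0F)) (proj₂ (as 1F))

    -- Residuation turns the right-hand side into `s · (s · a) ≤ b`. Positivity of `s` then yields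
    -- `a ≤ b`; conversely, `a` absorbs `p` and `b` absorbs `q`.
    ≤⇔φ≤ψ : ∀ p q (a : Component p) (b : Component q) →
            value a ≤ value b
              ⇔ φ {p} {p ∨⁺ q} (p≤p∨q p q) a ≤ᶜ ψ {q} {p ∨⁺ q} (q≤p∨q p q) b
    ≤⇔φ≤ψ p q a b = mk⇔
      (λ a≤b → ·≤⇒≤\\ (begin
        elem s · (elem s · value a)      ≈⟨ ·-absorbˡ s (value a) ⟩
        -- The factors of `s` are swapped to bring `p` next to `a`; the remaining `q` is carried
        -- across `a ≤ b`.
        elem p · elem q · value a        ≈⟨ ·-cong (central p (elem q)) Eq.refl ⟩
        elem q · elem p · value a        ≈⟨ assoc _ _ _ ⟩
        elem q · (elem p · value a)      ≈⟨ ·-cong Eq.refl (absorb-· (1[value] a)) ⟩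
        elem q · value a                 ≤⟨ ·-monoʳ _ a≤b ⟩
        elem q · value b                 ≈⟨ absorb-· (1[value] b) ⟩
        value b                          ∎))
      (λ sa≤s\\b → begin
        value a                          ≤⟨ x≤p·x _ (positive s) ⟩
        elem s · value a                 ≤⟨ x≤p·x _ (positive s) ⟩
        elem s · (elem s · value a)      ≤⟨ ≤\\⇒·≤ sa≤s\\b ⟩
        value b                          ∎)
      where
      open PosetReasoning poset
      s = p ∨⁺ q

corollary20 : ∀ {c ℓ₁ ℓ₂} (A : ResiduatedPoset c ℓ₁ ℓ₂) → let open ResiduatedPoset A in
    (balanced : Balanced)
    (1-·  : ∀ x y → 1[ x ] · 1[ y ] ≈ 1[ x · y ])
    (1-\\ : ∀ x y → 1[ x \\ y ] ≈ 1[ x ] · 1[ y ])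
    (1-// : ∀ x y → 1[ x // y ] ≈ 1[ x ] · 1[ y ]) →
    let open Decomposition A balanced 1-· 1-\\ 1-// in
    (Σ[ Ξ ∈ IsDirectedSystem (Id⁺ A balanced) components ξ ]
    IsIsomorphism (PłonkaSum (Id⁺ A balanced) components Ξ) algebraicReduct
    (λ x → Component.value (proj₂ x)))
    ×
    (∀ p q (a : Component p) (b : Component q) →
    Component.value a ≤ Component.value b
    ⇔ φ {p} {p ∨⁺ q} (p≤p∨q p q) a ≤ᶜ ψ {q} {p ∨⁺ q} (q≤p∨q p q) b)
corollary20 A balanced 1-· 1-\\ 1-// =
    ( isDirectedSystem balanced 1-· 1-\\ 1-//
    , isIsomorphism balanced 1-· 1-\\ 1-//)
  , ≤⇔φ≤ψ balanced 1-· 1-\\ 1-//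
  where open PłonkaDecomposition A
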